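{- Let $Z^{MSR}$, $L^{MSR}$, $V^{MSR}$ and $S^{MSR}$ be the classes of timed MSR systems (each taken together with an initial configuration and a critical configuration specification) satisfying, respectively, the $Z$, $L$, $V$ and $S$ properties with respect to lazy time sampling. Then $S^{MSR}\neq L^{MSR}$, and $L^{MSR}\subsetneq V^{MSR}\subsetneq Z^{MSR}$.
   Context: A fact is $P(u_1,\dots,u_n)$ over a finite first-order typed alphabet; a timestamped fact is $F@t$, $t\in\mathbb{N}$. A configuration is a finite multiset of ground timestamped facts with exactly one fact $Time@t$ (global time $t$). The $Tick$ rule is $Time@T\to Time@(T+1)$. An instantaneous rule has the form $Time@T, W_1@T_1,\dots,W_p@T_p, F_1@T_1',\dots,F_n@T_n' \mid \mathcal{C} \to \exists \vec X.[Time@T, W_1@T_1,\dots,W_p@T_p, Q_1@(T+d_1),\dots,Q_m@(T+d_m)]$ with $d_i\in\mathbb{N}$, $\mathcal{C}$ a set of constraints $T_a>T_b\pm d$ or $T_a=T_b\pm d$ over the precondition's time variables, $\vec X$ fresh values. A rule $\mathcal{W}\mid\mathcal{C}\to\exists\vec X.\mathcal{W}'$ applies to $\mathcal{S}$ if for a ground substitution $\sigma$, $\mathcal{W}\sigma\subseteq\mathcal{S}$ and $\mathcal{C}\sigma$ holds, giving $((\mathcal{S}\setminus\mathcal{W})\cup\mathcal{W}')\sigma$. A timed MSR system is a set of instantaneous rules plus $Tick$. A trace is a finite or infinite sequence of single rule applications; an infinite time trace is one in which the global time exceeds every $n\in\mathbb{N}$. A critical configuration specification is a set of pairs $\langle\mathcal{S}_j,\mathcal{C}_j\rangle$,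 $\mathcal{S}_j$ a finite multiset of facts $F@T$ with time variables, $\mathcal{C}_j$ constraints on them; $\mathcal{S}$ is critical if some $\mathcal{S}_j\sigma\subseteq\mathcal{S}$ with $\mathcal{C}_j\sigma$ true for a ground substitution $\sigma$ (nonces renamed). A trace is compliant if it contains no critical configuration. A trace uses lazy time sampling (l.t.s.) if whenever $\mathcal{S}_i\to_{Tick}\mathcal{S}_{i+1}$ occurs, no instantaneous rule instance is applicable to $\mathcal{S}_i$. With $\mathcal{S}_0$ the initial configuration: $Z$: there is a compliant infinite time trace from $\mathcal{S}_0$ using l.t.s. $S$: $Z$ and every infinite time trace from $\mathcal{S}_0$ using l.t.s. is compliant. A point-of-no-return is a non-critical configuration $\mathcal{S}$ such that every infinite trace from $\mathcal{S}$ using l.t.s. is not compliant. $V$: $Z$ and no configuration reachable from $\mathcal{S}_0$ by a compliant trace using l.t.s. is a point-of-no-return. $L$: $Z$ and for every configuration $\mathcal{S}$ reachable from $\mathcal{S}_0$ by a compliant trace using l.t.s., there is a compliant infinite time trace from $\mathcal{S}$ using l.t.s. -}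

module Defs where

open import Data.Nat using (ℕ; zero; suc; _+_; _<_)
open import Data.Integer using (ℤ; +_) renaming (_+_ to _+ℤ_; _<_ to _<ℤ_)
open import Data.Fin using (Fin)
open import Data.List using (List; []; _∷_; _++_; map; concatMap)
open import Data.List.Relation.Unary.All using (All; []; _∷_)
open import Data.List.Relation.Unary.Any using (Any)
open import Data.List.Relation.Unary.Unique.Propositional using (Unique)
open import Data.List.Relation.Binary.Pointwise using (Pointwise)
open import Data.List.Relation.Binary.Permutation.Propositional using (_↭_)
open import Data.List.Membership.Propositional using (_∈_; _∉_)
open import Data.Product using (Σ; _×_; _,_; proj₁; proj₂)
open import Data.Sum using (_⊎_)
open import Relation.Nullary using (¬_)
open import Relation.Binary.PropositionalEquality using (_≡_)

-- The special
-- nullary predicate Time is not among the predicate symbols; it is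
-- built into configurations and rules.

record Alphabet : Set where
  field
    nSort nConst nFun nPred : ℕ
    constSort : Fin nConst → Fin nSort
    funArgs   : Fin nFun → List (Fin nSort)
    funRes    : Fin nFun → Fin nSort
    predArgs  : Fin nPred → List (Fin nSort)

data Nonce : Set where
  nonce : ℕ → Nonce

module MSR (A : Alphabet) where
  open Alphabet A

  Sort : Set
  Sort = Fin nSort

  data Term (V : Set) : Sort → Set where
    var : ∀ {s} → V → Term V s
    con : (c : Fin nConst) → Term V (constSort c)
    app : (f : Fin nFun) → All (Term V) (funArgs f) → Term V (funRes f)

  record Fact (V : Set) : Set where
    constructor _⟨_⟩
    field
      pred : Fin nPred
      args : All (Term V) (predArgs pred)

  -- pattern terms: variables are names ℕ;  ground terms: "variables" are nonces
  PTerm : Sort → Set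
  PTerm = Term ℕ
  GTerm : Sort → Set
  GTerm = Term Nonce
  PFact : Set
  PFact = Fact ℕ
  GFact : Set
  GFact = Fact Nonce

  TSubst : Set
  TSubst = (s : Sort) → ℕ → GTerm s

  TimeSubst : Set
  TimeSubst = ℕ → ℕ

  mutual
    inst : TSubst → ∀ {s} → PTerm s → GTerm s
    inst σ {s} (var x) = σ s x
    inst σ (con c) = con c
    inst σ (app f ts) = app f (insts σ ts)

    insts : TSubst → ∀ {ss} → All PTerm ss → All GTerm ss
    insts σ [] = []
    insts σ (t ∷ ts) = inst σ t ∷ insts σ ts

  instF : TSubst → PFact → GFact
  instF σ (p ⟨ ts ⟩) = p ⟨ insts σ ts ⟩

  mutual
    noncesT : ∀ {s} → GTerm s → List ℕ
    noncesT (var (nonce k)) = k ∷ []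
    noncesT (con c) = []
    noncesT (app f ts) = noncesTs ts

    noncesTs : ∀ {ss} → All GTerm ss → List ℕ
    noncesTs [] = []
    noncesTs (t ∷ ts) = noncesT t ++ noncesTs ts

  noncesF : GFact → List ℕ
  noncesF (p ⟨ ts ⟩) = noncesTs ts

  -- A configuration: the unique fact Time@time, together with the finite
  -- multiset (list up to permutation) of the other ground timestamped facts.
  record Config : Set where
    constructor config
    field
      time  : ℕ
      facts : List (GFact × ℕ)
  open Config public

  noncesC : Config → List ℕ
  noncesC S = concatMap (λ ft → noncesF (proj₁ ft)) (facts S)

  -- Time constraints  Ta > Tb + z  or  Ta = Tb + z  (z ∈ ℤ covers ± d)
  data Rel : Set where
    gt eq : Rel

  record Constraint : Set where
    constructor constr
    field
      rel    : Rel
      lhs    : ℕ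
      rhs    : ℕ
      offset : ℤ

  Holds : TimeSubst → Constraint → Set
  Holds τ (constr gt a b z) = (+ τ b) +ℤ z <ℤ + τ a
  Holds τ (constr eq a b z) = + τ a ≡ (+ τ b) +ℤ z

  -- Instantaneous rule
  --  Time@T, W@Ts, F@Ts' | C → ∃ X. [Time@T, W@Ts, Q@(T+d)]
  record Rule : Set where
    field
      T        : ℕ
      kept     : List (PFact × ℕ)
      consumed : List (PFact × ℕ)
      guard    : List Constraint
      fresh    : List (Sort × ℕ)
      created  : List (PFact × ℕ)     -- Q_i @ (T + d_i)  (offsets d_i)
  open Rule public

  instAt : TSubst → TimeSubst → PFact × ℕ → GFact × ℕ
  instAt σ τ (f , x) = instF σ f , τ x

  FreshFor : TSubst → List (Sort × ℕ) → Config → Set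
  FreshFor σ X S = Σ (List ℕ) λ ks →
    Pointwise (λ sx k → σ (proj₁ sx) (proj₂ sx) ≡ var (nonce k)) X ks
    × Unique ks × All (_∉ noncesC S) ks

  RuleStep : Rule → Config → Config → Set
  RuleStep r S S' = Σ TSubst λ σ → Σ TimeSubst λ τ → Σ (List (GFact × ℕ)) λ rest →
      τ (T r) ≡ time S
    × facts S ↭ (map (instAt σ τ) (kept r ++ consumed r) ++ rest)
    × All (Holds τ) (guard r)
    × FreshFor σ (fresh r) S
    × time S' ≡ time S
    × facts S' ↭ (map (instAt σ τ) (kept r)
                   ++ map (λ fd → instF σ (proj₁ fd) , time S + proj₂ fd) (created r)
                   ++ rest)

  TickStep : Config → Config → Set
  TickStep S S' = time S' ≡ suc (time S) × facts S' ≡ facts S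

  data Atom (V : Set) : Set where
    timeA : Atom V
    factA : Fact V → Atom V

  instA : TSubst → TimeSubst → Atom ℕ × ℕ → Atom Nonce × ℕ
  instA σ τ (timeA , x) = timeA , τ x
  instA σ τ (factA f , x) = factA (instF σ f) , τ x

  record CritPattern : Set where
    field
      atoms : List (Atom ℕ × ℕ)
      cons  : List Constraint
  open CritPattern public

  allAtoms : Config → List (Atom Nonce × ℕ)
  allAtoms S = (timeA , time S) ∷ map (λ ft → factA (proj₁ ft) , proj₂ ft) (facts S)

  Matches : Config → CritPattern → Set
  Matches S P = Σ TSubst λ σ → Σ TimeSubst λ τ → Σ (List (Atom Nonce × ℕ)) λ rest →
    allAtoms S ↭ (map (instA σ τ) (atoms P) ++ rest) × All (Holds τ) (cons P)

  record TimedMSR : Set where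
    field
      rules : List Rule
      init  : Config
      spec  : List CritPattern
  open TimedMSR public

  module Props (M : TimedMSR) where
    Critical : Config → Set
    Critical S = Any (Matches S) (spec M)

    Applicable : Config → Set
    Applicable S = Σ Rule λ r → r ∈ rules M × Σ Config (RuleStep r S)

    LStep : Config → Config → Set
    LStep S S' = (Σ Rule λ r → r ∈ rules M × RuleStep r S S')
               ⊎ (¬ Applicable S × TickStep S S')

    LtsTrace : (ℕ → Config) → Set
    LtsTrace f = ∀ i → LStep (f i) (f (suc i))

    InfTime : (ℕ → Config) → Set
    InfTime f = ∀ n → Σ ℕ λ i → n < time (f i)

    Compliant : (ℕ → Config) → Set
    Compliant f = ∀ i → ¬ Critical (f i)

    data CReach : Config → Config → Set where
      done : ∀ {S} → ¬ Critical S → CReach S S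
      step : ∀ {S S' S''} → ¬ Critical S → LStep S S' → CReach S' S'' → CReach S S''

    GoodFrom : Config → Set
    GoodFrom S = Σ (ℕ → Config) λ f → f 0 ≡ S × LtsTrace f × InfTime f × Compliant f

    PointOfNoReturn : Config → Set
    PointOfNoReturn S = ¬ Critical S
      × (∀ f → f 0 ≡ S → LtsTrace f → ¬ Compliant f)

    Zp : Set
    Zp = GoodFrom (init M)

    Sp : Set
    Sp = Zp × (∀ f → f 0 ≡ init M → LtsTrace f → InfTime f → Compliant f)

    Vp : Set
    Vp = Zp × (∀ S → CReach (init M) S → ¬ PointOfNoReturn S)

    Lp : Set
    Lp = Zp × (∀ S → CReach (init M) S → GoodFrom S)

Instance : Set
Instance = Σ Alphabet MSR.TimedMSR

Z-MSR S-MSR V-MSR L-MSR : Instance → Set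
Z-MSR (A , M) = MSR.Props.Zp A M
S-MSR (A , M) = MSR.Props.Sp A M
V-MSR (A , M) = MSR.Props.Vp A M
L-MSR (A , M) = MSR.Props.Lp A M

{-# OPTIONS --safe #-}
-- The separating examples live over three nullary predicates a, b, c and start from a@0,
-- where one may move a to b or to c; moving to c and letting time pass is always fine.
-- In the first system nothing is critical, so S and V hold trivially, but a rule that
-- merely reads b is applicable as long as b is present: after moving to b, lazy time
-- sampling never lets time advance, and L fails.  In the second system no rule reads b
-- and a b-fact older than the current time is critical: after moving to b the only step
-- is a critical tick, a point of no return, so V fails while Z holds.  The inclusions
-- L ⊆ V ⊆ Z hold because a compliant infinite trace from a configuration shows that it
-- is not a point of no return.
module Submission where

open import Defs
open import Data.Product using (Σ; _×_; _,_; proj₁; proj₂)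
open import Data.Sum using (_⊎_; inj₁; inj₂; [_,_])
open import Data.Empty using (⊥-elim)
open import Data.Nat using (ℕ; zero; suc; _+_; _<_; z<s)
open import Data.Nat.Properties using (n<1+n; +-identityʳ; <-irrefl)
open import Data.Integer using (+_; +<+)
open import Data.Fin using (Fin; _≟_)
open import Data.List using (List; []; _∷_; _++_)
open import Data.List.Properties using (++-identityʳ)
open import Data.List.Relation.Unary.Any using (Any; here; there; any?)
open import Data.List.Relation.Unary.All using ([]; _∷_)
open import Data.List.Relation.Binary.Pointwise using ([])
open import Data.List.Relation.Unary.AllPairs using ([])
open import Data.List.Relation.Binary.Permutation.Propositional using (_↭_; ↭-refl; ↭-sym; ↭-trans; ↭-prep)
open import Data.List.Relation.Binary.Permutation.Propositional.Properties using (Any-resp-↭; ∈-resp-↭; map⁺; shift)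
open import Data.List.Membership.Propositional using (_∈_; find; lose)
open import Data.List.Membership.Propositional.Properties using (∈-∃++; ∈-map⁺; ∈-map⁻; ∈-++⁺ˡ)
open import Relation.Nullary using (¬_; Dec; yes; no)
open import Relation.Binary.PropositionalEquality using (_≡_; refl; sym; trans; subst)

∈⇒↭∷ : ∀ {A : Set} {x : A} {xs} → x ∈ xs → Σ (List A) λ rest → xs ↭ x ∷ rest
∈⇒↭∷ {x = x} x∈xs with ys , zs , refl ← ∈-∃++ x∈xs = ys ++ zs , shift x ys zs

module _ {A : Alphabet} where
  open MSR A

  RuleStep⇒premise∈ : ∀ {r S S′ φ} → RuleStep r S S′ → φ ∈ kept r ++ consumed r →
                      Σ TSubst λ σ → Σ TimeSubst λ τ → instAt σ τ φ ∈ facts S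
  RuleStep⇒premise∈ (σ , τ , _ , _ , pre , _) φ∈ =
    σ , τ , ∈-resp-↭ (↭-sym pre) (∈-++⁺ˡ (∈-map⁺ (instAt σ τ) φ∈))

  RuleStep-readOnly : ∀ {T ks C X S S′} →
    RuleStep (record { T = T ; kept = ks ; consumed = [] ; guard = C ; fresh = X ; created = [] }) S S′ →
    time S′ ≡ time S × facts S′ ↭ facts S
  RuleStep-readOnly {ks = ks} (σ , τ , rest , _ , pre , _ , _ , time≡ , post)
    rewrite ++-identityʳ ks = time≡ , ↭-trans post (↭-sym pre)

  timeA∈allAtoms : ∀ {S t} → (timeA , t) ∈ allAtoms S → t ≡ time S
  timeA∈allAtoms (here refl) = refl
  timeA∈allAtoms (there a∈) with _ , _ , () ← ∈-map⁻ _ a∈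

  factA∈allAtoms : ∀ {S φ t} → (factA φ , t) ∈ allAtoms S → (φ , t) ∈ facts S
  factA∈allAtoms (there a∈) with _ , φ∈ , refl ← ∈-map⁻ _ a∈ = φ∈

  allAtoms-extract : ∀ {S φ t} → (φ , t) ∈ facts S →
                     Σ _ λ rest → allAtoms S ↭ (timeA , time S) ∷ (factA φ , t) ∷ rest
  allAtoms-extract φ∈ with rest , p ← ∈⇒↭∷ φ∈ = _ , ↭-prep _ (map⁺ _ p)

  module _ (M : TimedMSR) where
    open Props M

    GoodFrom⇒¬PointOfNoReturn : ∀ {S} → GoodFrom S → ¬ PointOfNoReturn S
    GoodFrom⇒¬PointOfNoReturn (f , f0 , lts , _ , compliant) (_ , doomed) =
      doomed f f0 lts compliant

    Lp⇒Vp : Lp → Vp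
    Lp⇒Vp (z , good) = z , λ S reach → GoodFrom⇒¬PointOfNoReturn (good S reach)

    iterate : (∀ S → Σ Config (LStep S)) → Config → ℕ → Config
    iterate next S zero = S
    iterate next S (suc i) = proj₁ (next (iterate next S i))

    Sp-of-¬Critical : (∀ S → ¬ Critical S) → Zp → Sp
    Sp-of-¬Critical safe z = z , λ f _ _ _ i → safe (f i)

    Vp-of-¬Critical : (∀ S → ¬ Critical S) → (∀ S → Σ Config (LStep S)) → Zp → Vp
    Vp-of-¬Critical safe next z = z , λ S _ (_ , doomed) →
      doomed (iterate next S) refl (λ i → proj₂ (next (iterate next S i))) (λ i → safe _)

    critical-successors⇒PointOfNoReturn : ∀ {S} → ¬ Critical S →
      (∀ {S′} → LStep S S′ → Critical S′) → PointOfNoReturn S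
    critical-successors⇒PointOfNoReturn safe doom =
      safe , λ f f0 lts compliant → compliant 1 (doom (subst (λ X → LStep X (f 1)) f0 (lts 0)))

    ¬GoodFrom-of-frozen : ∀ (Inv : Config → Set) {t} →
      (∀ {S S′} → Inv S → LStep S S′ → Inv S′) → (∀ {S} → Inv S → time S ≡ t) →
      ∀ {S} → Inv S → ¬ GoodFrom S
    ¬GoodFrom-of-frozen Inv {t} closed frozen inv₀ (f , refl , lts , infTime , _)
      with i , t<time ← infTime t = <-irrefl (sym (frozen (inv i))) t<time
      where
      inv : ∀ i → Inv (f i)
      inv zero = inv₀
      inv (suc i) = closed (inv i) (lts i)

Alph : Alphabet
Alph = record { nSort = 1 ; nConst = 0 ; nFun = 0 ; nPred = 3
              ; constSort = λ () ; funArgs = λ () ; funRes = λ () ; predArgs = λ _ → [] }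

open MSR Alph

a b c : Fin 3
a = Fin.zero
b = Fin.suc Fin.zero
c = Fin.suc (Fin.suc Fin.zero)

fact : ∀ {V} → Fin 3 → Fact V
fact p = p ⟨ [] ⟩

fact-pred : ∀ {V} (φ : Fact V) → φ ≡ fact (Fact.pred φ)
fact-pred (p ⟨ [] ⟩) = refl

Present : Fin 3 → List (GFact × ℕ) → Set
Present p = Any (λ φt → Fact.pred (proj₁ φt) ≡ p)

present? : ∀ p xs → Dec (Present p xs)
present? p = any? (λ φt → Fact.pred (proj₁ φt) ≟ p)

Present-singleton : ∀ {p q t} → Present p ((fact q , t) ∷ []) → q ≡ p
Present-singleton (here q≡p) = q≡p

Present⇒↭∷ : ∀ {p xs} → Present p xs → Σ ℕ λ t → Σ _ λ rest → xs ↭ (fact p , t) ∷ rest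
Present⇒↭∷ present with (φ , t) , φ∈ , refl ← find present =
  t , ∈⇒↭∷ (subst (λ ψ → (ψ , t) ∈ _) (fact-pred φ) φ∈)

RuleStep⇒Present : ∀ r {S S′ p t} → RuleStep r S S′ → (fact p , t) ∈ kept r ++ consumed r →
                   Present p (facts S)
RuleStep⇒Present r step φ∈ with _ , _ , φ∈S ← RuleStep⇒premise∈ {r = r} step φ∈ = lose φ∈S refl

move : Fin 3 → Fin 3 → Rule
move p q = record { T = 0 ; kept = [] ; consumed = (fact p , 1) ∷ [] ; guard = []
                  ; fresh = [] ; created = (fact q , 0) ∷ [] }

observe : Fin 3 → Rule
observe p = record { T = 0 ; kept = (fact p , 1) ∷ [] ; consumed = [] ; guard = []
                   ; fresh = [] ; created = [] }

stepSubst : ℕ → ℕ → TimeSubst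
stepSubst now t zero = now
stepSubst now t (suc _) = t

noTerms : TSubst
noTerms _ _ = var (nonce 0)

move-step : ∀ {p q S t rest} → facts S ↭ (fact p , t) ∷ rest →
            RuleStep (move p q) S (config (time S) ((fact q , time S + 0) ∷ rest))
move-step {S = S} {t} {rest} p =
  noTerms , stepSubst (time S) t , rest , refl , p , [] , ([] , [] , [] , []) , refl , ↭-refl

observe-step : ∀ {p S t rest} → facts S ↭ (fact p , t) ∷ rest → RuleStep (observe p) S S
observe-step {S = S} {t} {rest} p =
  noTerms , stepSubst (time S) t , rest , refl , p , [] , ([] , [] , [] , []) , refl , p

start stalled : Config
start = config 0 ((fact a , 0) ∷ [])
stalled = config 0 ((fact b , 0) ∷ [])

escape : ℕ → Config
escape zero = start
escape (suc i) = config i ((fact c , 0) ∷ [])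

module Escape (M : TimedMSR) (init≡start : init M ≡ start) (a→c∈rules : move a c ∈ rules M)
  (applicable⇒ : ∀ {S} → Props.Applicable M S → Present a (facts S) ⊎ Present b (facts S)) where
  open Props M

  escape-lts : LtsTrace escape
  escape-lts zero = inj₁ (move a c , a→c∈rules , move-step ↭-refl)
  escape-lts (suc i) =
    inj₂ ((λ app → [ (λ { (here ()) }) , (λ { (here ()) }) ] (applicable⇒ app)) , refl , refl)

  escape-InfTime : InfTime escape
  escape-InfTime n = suc (suc n) , n<1+n n

  escape-good : (∀ i → ¬ Critical (escape i)) → Zp
  escape-good compliant = escape , sym init≡start , escape-lts , escape-InfTime , compliant

stallSystem : TimedMSR
stallSystem = record { rules = observe b ∷ move a b ∷ move a c ∷ [] ; init = start ; spec = [] }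

module Stall where
  open Props stallSystem

  ¬Critical : ∀ S → ¬ Critical S
  ¬Critical S ()

  applicable⇒ : ∀ {S} → Applicable S → Present a (facts S) ⊎ Present b (facts S)
  applicable⇒ (r , here refl , _ , ruleStep) = inj₂ (RuleStep⇒Present r ruleStep (here refl))
  applicable⇒ (r , there (here refl) , _ , ruleStep) = inj₁ (RuleStep⇒Present r ruleStep (here refl))
  applicable⇒ (r , there (there (here refl)) , _ , ruleStep) =
    inj₁ (RuleStep⇒Present r ruleStep (here refl))

  next : ∀ S → Σ Config (LStep S)
  next S with present? b (facts S) | present? a (facts S)
  ... | yes b∈ | _ with _ , _ , p ← Present⇒↭∷ b∈ =
    S , inj₁ (observe b , here refl , observe-step p)
  ... | no _ | yes a∈ with _ , _ , p ← Present⇒↭∷ a∈ =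
    _ , inj₁ (move a b , there (here refl) , move-step p)
  ... | no b∉ | no a∉ =
    config (suc (time S)) (facts S) , inj₂ ((λ app → [ a∉ , b∉ ] (applicable⇒ app)) , refl , refl)

  open Escape stallSystem refl (there (there (here refl))) applicable⇒

  Z : Zp
  Z = escape-good λ i → ¬Critical _

  Stalled : Config → Set
  Stalled S = time S ≡ 0 × facts S ↭ facts stalled

  stalled-closed : ∀ {S S′} → Stalled S → LStep S S′ → Stalled S′
  stalled-closed (time≡ , p) (inj₁ (_ , here refl , ruleStep))
    with time≡′ , p′ ← RuleStep-readOnly ruleStep = trans time≡′ time≡ , ↭-trans p′ p
  stalled-closed (_ , p) (inj₁ (r , there (here refl) , ruleStep))
    with () ← Present-singleton (Any-resp-↭ p (RuleStep⇒Present r ruleStep (here refl)))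
  stalled-closed (_ , p) (inj₁ (r , there (there (here refl)) , ruleStep))
    with () ← Present-singleton (Any-resp-↭ p (RuleStep⇒Present r ruleStep (here refl)))
  stalled-closed (_ , p) (inj₂ (¬applicable , _)) =
    ⊥-elim (¬applicable (observe b , here refl , _ , observe-step p))

  reach-stalled : CReach start stalled
  reach-stalled =
    step (¬Critical _) (inj₁ (move a b , there (here refl) , move-step ↭-refl)) (done (¬Critical _))

  ¬L : ¬ Lp
  ¬L (_ , good) = ¬GoodFrom-of-frozen stallSystem Stalled stalled-closed proj₁ (refl , ↭-refl)
                    (good stalled reach-stalled)

deadlineSystem : TimedMSR
deadlineSystem = record { rules = move a b ∷ move a c ∷ [] ; init = start ; spec = staleB ∷ [] }
  where
  staleB : CritPattern
  staleB = record { atoms = (timeA , 0) ∷ (factA (fact b) , 1) ∷ []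
                   ; cons = constr gt 0 1 (+ 0) ∷ [] }

module Deadline where
  open Props deadlineSystem

  Critical⇒stale : ∀ {S} → Critical S → Σ ℕ λ t → (fact b , t) ∈ facts S × t < time S
  Critical⇒stale (here (_ , τ , _ , p , (+<+ lt ∷ [])))
    with refl ← timeA∈allAtoms (∈-resp-↭ (↭-sym p) (here refl)) =
    τ 1 , factA∈allAtoms (∈-resp-↭ (↭-sym p) (there (here refl)))
        , subst (_< τ 0) (+-identityʳ (τ 1)) lt

  stale⇒Critical : ∀ {S t} → (fact b , t) ∈ facts S → t < time S → Critical S
  stale⇒Critical {S} {t} b∈ lt with rest , p ← allAtoms-extract b∈ =
    here ( noTerms , stepSubst (time S) t , rest , p
         , (+<+ (subst (_< time S) (sym (+-identityʳ t)) lt) ∷ []))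

  applicable⇒ : ∀ {S} → Applicable S → Present a (facts S)
  applicable⇒ (r , here refl , _ , ruleStep) = RuleStep⇒Present r ruleStep (here refl)
  applicable⇒ (r , there (here refl) , _ , ruleStep) = RuleStep⇒Present r ruleStep (here refl)

  open Escape deadlineSystem refl (there (here refl)) (λ app → inj₁ (applicable⇒ app))

  ¬Critical-without-b : ∀ {S} → ¬ Present b (facts S) → ¬ Critical S
  ¬Critical-without-b {S} b∉ stale with _ , b∈ , _ ← Critical⇒stale {S} stale =
    b∉ (lose b∈ refl)

  escape-safe : ∀ i → ¬ Critical (escape i)
  escape-safe zero = ¬Critical-without-b λ { (here ()) }
  escape-safe (suc i) = ¬Critical-without-b λ { (here ()) }

  Z : Zp
  Z = escape-good escape-safe

  stalled-safe : ¬ Critical stalled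
  stalled-safe stale with _ , here refl , () ← Critical⇒stale stale

  stalled-doomed : ∀ {S′} → LStep stalled S′ → Critical S′
  stalled-doomed (inj₁ (r , here refl , ruleStep))
    with () ← Present-singleton (RuleStep⇒Present r ruleStep (here refl))
  stalled-doomed (inj₁ (r , there (here refl) , ruleStep))
    with () ← Present-singleton (RuleStep⇒Present r ruleStep (here refl))
  stalled-doomed (inj₂ (_ , time≡ , refl)) = stale⇒Critical (here refl) (subst (0 <_) (sym time≡) z<s)

  ¬V : ¬ Vp
  ¬V (_ , noReturn) = noReturn stalled
    (step (escape-safe 0) (inj₁ (move a b , here refl , move-step ↭-refl)) (done stalled-safe))
    (critical-successors⇒PointOfNoReturn deadlineSystem stalled-safe stalled-doomed)

corollary1 : ¬ (∀ (I : Instance) → (S-MSR I → L-MSR I) × (L-MSR I → S-MSR I))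
    × ((∀ (I : Instance) → L-MSR I → V-MSR I) × Σ Instance (λ I → V-MSR I × ¬ L-MSR I))
    × ((∀ (I : Instance) → V-MSR I → Z-MSR I) × Σ Instance (λ I → Z-MSR I × ¬ V-MSR I))
corollary1 =
    (λ S⇔L → Stall.¬L (proj₁ (S⇔L stall) stall-S))
  , ((λ (A , M) → Lp⇒Vp M) , stall , stall-V , Stall.¬L)
  , ((λ _ → proj₁) , (Alph , deadlineSystem) , Deadline.Z , Deadline.¬V)
  where
  stall : Instance
  stall = Alph , stallSystem
  stall-S : S-MSR stall
  stall-S = Sp-of-¬Critical stallSystem Stall.¬Critical Stall.Z
  stall-V : V-MSR stall
  stall-V = Vp-of-¬Critical stallSystem Stall.¬Critical Stall.next Stall.Z
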